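{- For every $n\ge1$, the number of fixed points $\mathrm{fix}$ is $1$-mesic under cyclic valley-hopping on $\mathfrak{S}_n$: for every cyclic valley-hopping orbit $\Pi'\subseteq\mathfrak{S}_n$, $\frac{1}{|\Pi'|}\sum_{\tau\in\Pi'}\mathrm{fix}(\tau)=1$.
   Context: Permutations are written in one-line notation with convention $\pi_0=\pi_{n+1}=\infty$. A letter $\pi_i$ is a peak if $\pi_{i-1}<\pi_i>\pi_{i+1}$, a valley if $\pi_{i-1}>\pi_i<\pi_{i+1}$, a double ascent if $\pi_{i-1}<\pi_i<\pi_{i+1}$, a double descent if $\pi_{i-1}>\pi_i>\pi_{i+1}$. Valley-hopping: for $x\in[n]$ write $\pi=w_1w_2xw_4w_5$ with $w_2$ (resp. $w_4$) the maximal consecutive subword immediately left (resp. right) of $x$ all of whose letters are smaller than $x$; $\varphi_x(\pi)=w_1w_4xw_2w_5$ if $x$ is a double ascent or double descent, and $\varphi_x(\pi)=\pi$ if $x$ is a peak or valley. These involutions commute. Canonical cycle representation: each cycle written with its largest element first, cycles in increasing order of their largest elements. Foata's fundamental transformation $o$ writes a permutation in canonical cycle representation and erases parentheses, giving a one-line permutation. Let $\psi_x=o^{ -1}\circ\varphi_x\circ o$ and $\psi_S=\prod_{x\in S}\psi_x$ for $S\subseteq[n]$; the cyclic valley-hopping orbit of $\tau$ is $\{\psi_S(\tau):S\subseteq[n]\}$. $\mathrm{fix}(\tau)$ is the number of fixed points of $\tau$. A statistic is $c$-mesic under an action if its average over every orbit is $c$. -}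

module Defs where

open import Data.Bool using (Bool; true; false; if_then_else_; _∧_; _∨_; not)
open import Data.Nat using (ℕ; zero; suc; _≡ᵇ_; _<ᵇ_; _≤ᵇ_)
open import Data.List using (List; []; _∷_; _++_; map; length; reverse; deduplicate; upTo; concatMap; foldr)
open import Data.List.Properties using (≡-dec)
open import Data.Maybe using (Maybe; just; nothing)
open import Data.Product using (_×_; _,_; proj₁; proj₂)
import Data.Nat as N

-- Permutations of [n] are lists (one-line notation) with values 1..n.
range1 : ℕ → List ℕ
range1 n = map suc (upTo n)

-- one-line word as a function: π(i) for 1-based i (0 outside range)
app : List ℕ → ℕ → ℕ
app []       _             = 0
app (x ∷ xs) zero          = 0
app (x ∷ xs) (suc zero)    = x
app (x ∷ xs) (suc (suc i)) = app xs (suc i)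

fixFrom : ℕ → List ℕ → ℕ
fixFrom i []       = 0
fixFrom i (x ∷ xs) = (if x ≡ᵇ i then 1 else 0) N.+ fixFrom (suc i) xs

fix : List ℕ → ℕ
fix π = fixFrom 1 π

cycleGo : List ℕ → ℕ → ℕ → ℕ → List ℕ
cycleGo τ m zero    x = []
cycleGo τ m (suc k) x = if x ≡ᵇ m then [] else x ∷ cycleGo τ m k (app τ x)

cycleFrom : List ℕ → ℕ → List ℕ
cycleFrom τ m = m ∷ cycleGo τ m (length τ) (app τ m)

isCycleMax : List ℕ → ℕ → Bool
isCycleMax τ m = allLe m (cycleFrom τ m)
  where
    allLe : ℕ → List ℕ → Bool
    allLe m []       = true
    allLe m (y ∷ ys) = (y ≤ᵇ m) ∧ allLe m ys

-- canonical cycle representation (largest element first in each cycle,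
-- cycles ordered by increasing largest elements), parentheses erased
foata : List ℕ → List ℕ
foata τ = concatMap (λ m → if isCycleMax τ m then cycleFrom τ m else []) (range1 (length τ))

-- inverse: cut the word before each left-to-right maximum into cycles
cutAux : ℕ → List ℕ → List ℕ × List (List ℕ)
cutAux m [] = [] , []
cutAux m (x ∷ xs) with m <ᵇ x
... | true  = [] , ((x ∷ proj₁ (cutAux x xs)) ∷ proj₂ (cutAux x xs))
... | false = (x ∷ proj₁ (cutAux m xs)) , proj₂ (cutAux m xs)

cycles : List ℕ → List (List ℕ)
cycles w = proj₂ (cutAux 0 w)

nextAfter : ℕ → List ℕ → ℕ → Maybe ℕ
nextAfter f []           x = nothing
nextAfter f (y ∷ [])     x = if y ≡ᵇ x then just f else nothing
nextAfter f (y ∷ z ∷ ys) x = if y ≡ᵇ x then just z else nextAfter f (z ∷ ys) x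

imgCycles : List (List ℕ) → ℕ → ℕ
imgCycles []             x = x
imgCycles ([] ∷ cs)      x = imgCycles cs x
imgCycles ((f ∷ r) ∷ cs) x with nextAfter f (f ∷ r) x
... | just y  = y
... | nothing = imgCycles cs x

foataInv : List ℕ → List ℕ
foataInv w = map (imgCycles (cycles w)) (range1 (length w))

-- valley-hopping φ_x (boundary convention π₀ = π_{n+1} = ∞)

takeLt : ℕ → List ℕ → List ℕ
takeLt x []       = []
takeLt x (y ∷ ys) = if y <ᵇ x then y ∷ takeLt x ys else []

dropLt : ℕ → List ℕ → List ℕ
dropLt x []       = []
dropLt x (y ∷ ys) = if y <ᵇ x then dropLt x ys else y ∷ ys

splitAt' : ℕ → List ℕ → List ℕ × List ℕ
splitAt' x [] = [] , []
splitAt' x (y ∷ ys) =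
  if y ≡ᵇ x then ([] , ys) else ((y ∷ proj₁ (splitAt' x ys)) , proj₂ (splitAt' x ys))

-- neighbours, nothing = ∞
lastM : List ℕ → Maybe ℕ
lastM []           = nothing
lastM (y ∷ [])     = just y
lastM (y ∷ z ∷ ys) = lastM (z ∷ ys)

headM : List ℕ → Maybe ℕ
headM []       = nothing
headM (y ∷ ys) = just y

-- "a < b" with nothing read as ∞
ltM : Maybe ℕ → ℕ → Bool
ltM nothing  b = false
ltM (just a) b = a <ᵇ b

isPeakAt : ℕ → List ℕ → Bool
isPeakAt x π = ltM (lastM (proj₁ (splitAt' x π))) x ∧ ltM (headM (proj₂ (splitAt' x π))) x

isValleyAt : ℕ → List ℕ → Bool
isValleyAt x π = not (ltM (lastM (proj₁ (splitAt' x π))) x) ∧ not (ltM (headM (proj₂ (splitAt' x π))) x)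

φ : ℕ → List ℕ → List ℕ
φ x π =
  if isPeakAt x π ∨ isValleyAt x π then π
  else (w1 ++ w4 ++ x ∷ w2 ++ w5)
  where
    left  = proj₁ (splitAt' x π)
    right = proj₂ (splitAt' x π)
    w2 = reverse (takeLt x (reverse left))
    w1 = reverse (dropLt x (reverse left))
    w4 = takeLt x right
    w5 = dropLt x right

ψ : ℕ → List ℕ → List ℕ
ψ x τ = foataInv (φ x (foata τ))

ψS : List ℕ → List ℕ → List ℕ
ψS S τ = foldr ψ τ S

subsets : List ℕ → List (List ℕ)
subsets []       = [] ∷ []
subsets (x ∷ xs) = subsets xs ++ map (x ∷_) (subsets xs)

orbit : List ℕ → List (List ℕ)
orbit τ = deduplicate (≡-dec N._≟_) (map (λ S → ψS S τ) (subsets (range1 (length τ))))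

{-# OPTIONS --safe #-}
module Submission where

-- Count pairs (σ, x) with σ in the orbit and x a fixed point of σ. In one-line notation x is fixed
-- by o⁻¹(v) iff every letter of v before x is smaller and the next letter, if any, is larger. For
-- v = φₓ(w), w = w₁ w₂ x w₄ w₅, this says that w₁ and w₂ are empty: x is the first letter of w. Since
-- ψₓ permutes the orbit, x is fixed in as many members of the orbit as have x as the first letter of
-- their image under o, and summing over x counts every member exactly once.
--
-- The orbit is stable under ψₓ because the φₓ are commuting involutions: a word is the inorder
-- reading of a decreasing binary tree, and φₓ exchanges the two subtrees of x when exactly one of
-- them is empty.

open import Defs
open import Data.Bool using (Bool; true; false; if_then_else_; _∧_; _∨_; _xor_; not; T)
open import Data.Bool.Properties using (T-≡; xor-comm; xor-same; xor-identityʳ)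
open import Data.Empty using (⊥-elim)
open import Data.List
  using (List; []; _∷_; _++_; map; length; null; reverse; foldr; concat; concatMap; upTo; applyUpTo;
         deduplicate)
open import Data.List.Membership.Propositional using (_∈_; _∉_)
open import Data.List.Membership.Propositional.Properties
  using (∈-++⁺ˡ; ∈-++⁺ʳ; ∈-++⁻; ∈-∃++; ∈-insert; ∈-map⁺; ∈-map⁻; ∈-upTo⁻; ∈-concat⁺′; ∈-concat⁻′;
         ∈-deduplicate⁺; ∈-deduplicate⁻)
open import Data.List.Properties
  using (≡-dec; ++-assoc; ++-identityʳ; reverse-++; reverse-involutive; unfold-reverse; map-++; map-∘;
         map-cong-local; map-upTo; map-applyUpTo; length-map; length-upTo; length-++)
open import Data.List.Relation.Binary.Permutation.Propositional
  using (_↭_; ↭-refl; ↭-sym; ↭-trans; ↭-prep; ↭-reflexive; ↭⇒↭ₛ; ↭-swap)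
open import Data.List.Relation.Binary.Permutation.Propositional.Properties
  using (All-resp-↭; ∈-resp-↭; shift; ++⁺; ++-comm; drop-∷; ∷↭∷ʳ; ↭-empty-inv; ↭-length; ↭-reverse)
  renaming (map⁺ to ↭-map⁺)
open import Data.List.Relation.Binary.Subset.Propositional using (_⊆_)
open import Data.List.Relation.Unary.All as All using (All; []; _∷_)
open import Data.List.Relation.Unary.All.Properties using (++⁻ˡ) renaming (++⁺ to All-++⁺; map⁺ to All-map⁺)
open import Data.List.Relation.Unary.AllPairs using (AllPairs; []; _∷_; head)
open import Data.List.Relation.Unary.Any using (here; there)
open import Data.List.Relation.Unary.Unique.Propositional using (Unique)
open import Data.List.Relation.Unary.Unique.Propositional.Properties using (Unique[x∷xs]⇒x∉xs)
open import Data.Maybe using (nothing; just)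
open import Data.Nat using (ℕ; zero; suc; _+_; _∸_; _≤_; _<_; _≡ᵇ_; _<ᵇ_; _≤ᵇ_; z≤n; s≤s; s≤s⁻¹; _≟_; _<?_)
open import Data.Nat.ListAction using (sum)
open import Data.Nat.ListAction.Properties using (sum-↭)
open import Data.Nat.Properties
  using (+-identityʳ; +-suc; <-asym; <-irrefl; <-trans; <-≤-trans; <ᵇ⇒<; <⇒<ᵇ; <⇒≢; <⇒≤; <⇒≱;
         m+[n∸m]≡n; m≤m+n; m≤n+m; n≤1+n; suc-injective; ≡ᵇ⇒≡; ≡⇒≡ᵇ; ≤-<-trans; ≤-refl; ≤-reflexive;
         ≤-trans; ≤ᵇ⇒≤; ≤⇒≤ᵇ; ≤∧≢⇒<; ≮⇒≥; +-commutativeSemigroup)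
open import Data.Product using (∃; ∃₂; _×_; _,_; proj₁; proj₂)
open import Data.Sum using (_⊎_; inj₁; inj₂; [_,_]′)
open import Function using (_∘_; id; Equivalence)
open import Relation.Binary.PropositionalEquality
  using (_≡_; _≢_; refl; sym; ≢-sym; trans; cong; cong₂; subst; setoid; module ≡-Reasoning)
open import Relation.Nullary using (¬_; yes; no)
import Data.List.Relation.Binary.Permutation.Setoid.Properties as Permutationₛ
import Data.List.Relation.Unary.AllPairs.Properties as AllPairs
open import Algebra.Properties.CommutativeSemigroup +-commutativeSemigroup
  using () renaming (interchange to +-interchange)
open import Data.List.Relation.Unary.Unique.DecPropositional.Properties (≡-dec _≟_) using (deduplicate-!)

-- Comparisons, duplicate-free lists, and valley-hopping on words

≡true : ∀ {b} → T b → b ≡ true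
≡true = Equivalence.to T-≡

≡false : ∀ {b} → ¬ T b → b ≡ false
≡false {false} _  = refl
≡false {true}  ¬t = ⊥-elim (¬t _)

<ᵇ-true : ∀ {m n} → m < n → (m <ᵇ n) ≡ true
<ᵇ-true m<n = ≡true (<⇒<ᵇ m<n)

<ᵇ-false : ∀ {m n} → ¬ m < n → (m <ᵇ n) ≡ false
<ᵇ-false {m} {n} m≮n = ≡false (m≮n ∘ <ᵇ⇒< m n)

≡ᵇ-refl : ∀ n → (n ≡ᵇ n) ≡ true
≡ᵇ-refl n = ≡true (≡⇒≡ᵇ n n refl)

≡ᵇ-false : ∀ {m n} → m ≢ n → (m ≡ᵇ n) ≡ false
≡ᵇ-false {m} {n} m≢n = ≡false (m≢n ∘ ≡ᵇ⇒≡ m n)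

Unique-resp-↭ : ∀ {A : Set} {xs ys : List A} → xs ↭ ys → Unique xs → Unique ys
Unique-resp-↭ {A} p = Permutationₛ.Unique-resp-↭ (setoid A) (↭⇒↭ₛ p)

Unique-mid : ∀ {A : Set} (us : List A) {x vs} → Unique (us ++ x ∷ vs) → x ∉ us ++ vs
Unique-mid us {x} {vs} u = Unique[x∷xs]⇒x∉xs (Unique-resp-↭ (shift x us vs) u)

Unique-++⁻ʳ : ∀ {A : Set} (us : List A) {vs} → Unique (us ++ vs) → Unique vs
Unique-++⁻ʳ []       u       = u
Unique-++⁻ʳ (_ ∷ us) (_ ∷ u) = Unique-++⁻ʳ us u

Unique-++⁻ˡ : ∀ {A : Set} (us : List A) {vs} → Unique (us ++ vs) → Unique us
Unique-++⁻ˡ us {vs} u = Unique-++⁻ʳ vs (Unique-resp-↭ (++-comm us vs) u)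

Unique-disjoint : ∀ {A : Set} (us : List A) {vs x} → Unique (us ++ vs) → x ∈ us → x ∉ vs
Unique-disjoint (_ ∷ us) u       (here refl) x∈vs = Unique[x∷xs]⇒x∉xs u (∈-++⁺ʳ us x∈vs)
Unique-disjoint (_ ∷ us) (_ ∷ u) (there p)   x∈vs = Unique-disjoint us u p x∈vs

-- The word is empty or starts with a letter that stops a run of letters smaller than x.
data HeadGt (x : ℕ) : List ℕ → Set where
  none : HeadGt x []
  some : ∀ {y ys} → x < y → HeadGt x (y ∷ ys)

HeadGt-++ : ∀ {x y us vs} → HeadGt x us → x < y → HeadGt x (us ++ y ∷ vs)
HeadGt-++ none     x<y = some x<y
HeadGt-++ (some p) _   = some p

takeLt-++ : ∀ {x us vs} → All (_< x) us → HeadGt x vs → takeLt x (us ++ vs) ≡ us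
takeLt-++ []       none     = refl
takeLt-++ []       (some p) rewrite <ᵇ-false (<-asym p) = refl
takeLt-++ (p ∷ ps) h        rewrite <ᵇ-true p = cong (_ ∷_) (takeLt-++ ps h)

dropLt-++ : ∀ {x us vs} → All (_< x) us → HeadGt x vs → dropLt x (us ++ vs) ≡ vs
dropLt-++ []       none     = refl
dropLt-++ []       (some p) rewrite <ᵇ-false (<-asym p) = refl
dropLt-++ (p ∷ ps) h        rewrite <ᵇ-true p = dropLt-++ ps h

-- A nonempty run puts a smaller letter next to `x`; after an empty run comes a larger letter or the
-- boundary, which counts as infinity.
ltM-headM : ∀ {x us vs} → All (_< x) us → HeadGt x vs → ltM (headM (us ++ vs)) x ≡ not (null us)
ltM-headM []      none     = refl
ltM-headM []      (some p) = <ᵇ-false (<-asym p)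
ltM-headM (p ∷ _) h        = <ᵇ-true p

splitAt′-++ : ∀ {x} us {vs} → x ∉ us → splitAt' x (us ++ x ∷ vs) ≡ (us , vs)
splitAt′-++ {x} []       x∉ rewrite ≡ᵇ-refl x = refl
splitAt′-++ {x} (u ∷ us) {vs} x∉
  rewrite ≡ᵇ-false {u} {x} (x∉ ∘ here ∘ sym) | splitAt′-++ us {vs} (x∉ ∘ there) = refl

lastM-∷ʳ : ∀ us {y} → lastM (us ++ y ∷ []) ≡ just y
lastM-∷ʳ []           = refl
lastM-∷ʳ (_ ∷ [])     = refl
lastM-∷ʳ (_ ∷ u ∷ us) = lastM-∷ʳ (u ∷ us)

lastM-reverse : ∀ us → lastM (reverse us) ≡ headM us
lastM-reverse []       = refl
lastM-reverse (u ∷ us) rewrite unfold-reverse u us = lastM-∷ʳ (reverse us)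

-- Reversal turns the left side of `x` into a right side, so the results on runs to the right of `x`
-- apply to both.
lastM≡headM∘reverse : ∀ us → lastM us ≡ headM (reverse us)
lastM≡headM∘reverse us =
  trans (cong lastM (sym (reverse-involutive us))) (lastM-reverse (reverse us))

null-reverse : ∀ {A : Set} (us : List A) → null (reverse us) ≡ null us
null-reverse []       = refl
null-reverse (u ∷ us) rewrite unfold-reverse u us = null-∷ʳ (reverse us)
  where
  null-∷ʳ : ∀ {A : Set} (vs : List A) {v} → null (vs ++ v ∷ []) ≡ false
  null-∷ʳ []      = refl
  null-∷ʳ (_ ∷ _) = refl

-- Here `p` and `q` say that the left and right runs are empty. A peak has neither run empty and a
-- valley has both, so `φ` moves `x` exactly when `p xor q` holds.
peak∨valley : ∀ p q → not p ∧ not q ∨ not (not p) ∧ not (not q) ≡ not (p xor q)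
peak∨valley true  true  = refl
peak∨valley true  false = refl
peak∨valley false true  = refl
peak∨valley false false = refl

if-not : ∀ {A : Set} b {s t : A} → (if not b then s else t) ≡ (if b then t else s)
if-not true  = refl
if-not false = refl

-- x sits in the word w₁ w₂ x w₄ w₅ between the maximal runs w₂ and w₄ of smaller letters.
record Factors (x : ℕ) (w₁ w₂ w₄ w₅ : List ℕ) : Set where
  constructor factors
  field
    left-stop   : HeadGt x (reverse w₁)
    left-small  : All (_< x) w₂
    right-small : All (_< x) w₄
    right-stop  : HeadGt x w₅

-- The value of valley-hopping in terms of the runs: exactly one of them is empty precisely at a
-- double ascent or a double descent.
hop : ℕ → (w₁ w₂ w₄ w₅ : List ℕ) → List ℕ
hop x w₁ w₂ w₄ w₅ =
  if null w₂ xor null w₄ then w₁ ++ w₄ ++ x ∷ w₂ ++ w₅ else w₁ ++ w₂ ++ x ∷ w₄ ++ w₅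

-- The letters being distinct, `splitAt'` cuts at this occurrence of `x`; the stopping letters then
-- make `takeLt` and `dropLt` return the given runs.
φ-factors : ∀ {x} w₁ w₂ {w₄ w₅} → Factors x w₁ w₂ w₄ w₅ → Unique (w₁ ++ w₂ ++ x ∷ w₄ ++ w₅) →
            φ x (w₁ ++ w₂ ++ x ∷ w₄ ++ w₅) ≡ hop x w₁ w₂ w₄ w₅
φ-factors {x} w₁ w₂ {w₄} {w₅} (factors lh ls rs rh) u
  -- `φ` scans the left side from `x` outwards, hence through the reversed run.
  with ls′ ← All-resp-↭ (↭-sym (↭-reverse w₂)) ls
  rewrite sym (++-assoc w₁ w₂ (x ∷ w₄ ++ w₅))
        | splitAt′-++ {x} (w₁ ++ w₂) {w₄ ++ w₅} (Unique-mid (w₁ ++ w₂) u ∘ ∈-++⁺ˡ)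
        | lastM≡headM∘reverse (w₁ ++ w₂)
        | reverse-++ w₁ w₂
        | ltM-headM ls′ lh
        | ltM-headM rs rh
        | takeLt-++ ls′ lh
        | dropLt-++ ls′ lh
        | takeLt-++ rs rh
        | dropLt-++ rs rh
        | null-reverse w₂
        | reverse-involutive w₁
        | reverse-involutive w₂
        | peak∨valley (null w₂) (null w₄)
        | ++-assoc w₁ w₂ (x ∷ w₄ ++ w₅)
  = if-not (null w₂ xor null w₄)
-- Decreasing binary trees

data Tree : Set where
  leaf : Tree
  node : Tree → ℕ → Tree → Tree

inorder : Tree → List ℕ
inorder leaf         = []
inorder (node l x r) = inorder l ++ x ∷ inorder r

isLeaf : Tree → Bool
isLeaf leaf         = true
isLeaf (node _ _ _) = false

-- Keeping the decision as a Boolean lets two successive swaps combine by `xor`.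
swapIf : Bool → Tree → ℕ → Tree → Tree
swapIf b l x r = if b then node r x l else node l x r

-- The recursion visits every node, and the test is made on the subtrees before they are flipped.
flip : ℕ → Tree → Tree
flip x leaf         = leaf
flip x (node l y r) = swapIf ((x ≡ᵇ y) ∧ (isLeaf l xor isLeaf r)) (flip x l) y (flip x r)

isLeaf-swapIf : ∀ b l x r → isLeaf (swapIf b l x r) ≡ false
isLeaf-swapIf true  l x r = refl
isLeaf-swapIf false l x r = refl

isLeaf-flip : ∀ x t → isLeaf (flip x t) ≡ isLeaf t
isLeaf-flip x leaf         = refl
isLeaf-flip x (node l y r) = isLeaf-swapIf ((x ≡ᵇ y) ∧ (isLeaf l xor isLeaf r)) (flip x l) y (flip x r)

-- The test `isLeaf l xor isLeaf r` is symmetric, so an earlier swap of the subtrees does not change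
-- the decision of `flip x`.
flip-swapIf : ∀ x b l y r → flip x (swapIf b l y r) ≡
              swapIf (((x ≡ᵇ y) ∧ (isLeaf l xor isLeaf r)) xor b) (flip x l) y (flip x r)
flip-swapIf x false l y r = cong (λ b → swapIf b (flip x l) y (flip x r)) (sym (xor-identityʳ _))
flip-swapIf x true  l y r
  rewrite xor-comm (isLeaf r) (isLeaf l) with (x ≡ᵇ y) ∧ (isLeaf l xor isLeaf r)
... | true  = refl
... | false = refl

-- Flipping preserves whether a subtree is empty, so both flips meet the same test at `z`.
-- Commutativity and involutivity then reduce to those of `xor`.
flip-flip : ∀ x y l z r → flip x (flip y (node l z r)) ≡
            swapIf (((x ≡ᵇ z) ∧ (isLeaf l xor isLeaf r)) xor ((y ≡ᵇ z) ∧ (isLeaf l xor isLeaf r)))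
                   (flip x (flip y l)) z (flip x (flip y r))
flip-flip x y l z r
  rewrite flip-swapIf x ((y ≡ᵇ z) ∧ (isLeaf l xor isLeaf r)) (flip y l) z (flip y r)
        | isLeaf-flip y l | isLeaf-flip y r = refl

flip-comm : ∀ x y t → flip x (flip y t) ≡ flip y (flip x t)
flip-comm x y leaf = refl
flip-comm x y (node l z r)
  rewrite flip-flip x y l z r | flip-flip y x l z r | flip-comm x y l | flip-comm x y r
        | xor-comm ((x ≡ᵇ z) ∧ (isLeaf l xor isLeaf r)) ((y ≡ᵇ z) ∧ (isLeaf l xor isLeaf r)) = refl

flip-involutive : ∀ x t → flip x (flip x t) ≡ t
flip-involutive x leaf = refl
flip-involutive x (node l z r)
  rewrite flip-flip x x l z r | flip-involutive x l | flip-involutive x r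
        | xor-same ((x ≡ᵇ z) ∧ (isLeaf l xor isLeaf r)) = refl

inorder-swapIf : ∀ b l x r → inorder (swapIf b l x r) ↭ inorder (node l x r)
inorder-swapIf false l x r = ↭-refl
inorder-swapIf true  l x r =
  ↭-trans (shift x (inorder r) (inorder l))
    (↭-trans (↭-prep x (++-comm (inorder r) (inorder l))) (↭-sym (shift x (inorder l) (inorder r))))

inorder-flip : ∀ x t → inorder (flip x t) ↭ inorder t
inorder-flip x leaf         = ↭-refl
inorder-flip x (node l y r) =
  ↭-trans (inorder-swapIf ((x ≡ᵇ y) ∧ (isLeaf l xor isLeaf r)) (flip x l) y (flip x r))
    (++⁺ (inorder-flip x l) (↭-prep y (inorder-flip x r)))

data Decreasing : Tree → Set where
  leaf : Decreasing leaf
  node : ∀ {l x r} → Decreasing l → All (_< x) (inorder l) →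
         Decreasing r → All (_< x) (inorder r) → Decreasing (node l x r)

flip-decreasing : ∀ x {t} → Decreasing t → Decreasing (flip x t)
flip-decreasing x leaf = leaf
flip-decreasing x {node l y r} (node dl al dr ar) with (x ≡ᵇ y) ∧ (isLeaf l xor isLeaf r)
... | false = node (flip-decreasing x dl) (All-resp-↭ (↭-sym (inorder-flip x l)) al)
                   (flip-decreasing x dr) (All-resp-↭ (↭-sym (inorder-flip x r)) ar)
... | true  = node (flip-decreasing x dr) (All-resp-↭ (↭-sym (inorder-flip x r)) ar)
                   (flip-decreasing x dl) (All-resp-↭ (↭-sym (inorder-flip x l)) al)

flip-∉ : ∀ x t → x ∉ inorder t → flip x t ≡ t
flip-∉ x leaf         x∉ = refl
flip-∉ x (node l y r) x∉
  rewrite ≡ᵇ-false {x} {y} (λ { refl → x∉ (∈-insert (inorder l)) })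
        | flip-∉ x l (x∉ ∘ ∈-++⁺ˡ) | flip-∉ x r (x∉ ∘ ∈-++⁺ʳ (inorder l) ∘ there) = refl

-- The new first letter descends the left spine past the larger letters; the subtree at which it
-- stops becomes its right subtree.
consTree : ℕ → Tree → Tree
consTree x leaf         = node leaf x leaf
consTree x (node l y r) = if y <ᵇ x then node leaf x (node l y r) else node (consTree x l) y r

toTree : List ℕ → Tree
toTree = foldr consTree leaf

inorder-consTree : ∀ x t → inorder (consTree x t) ≡ x ∷ inorder t
inorder-consTree x leaf = refl
inorder-consTree x (node l y r) with y <ᵇ x
... | true  = refl
... | false = cong (_++ y ∷ inorder r) (inorder-consTree x l)

inorder-toTree : ∀ w → inorder (toTree w) ≡ w
inorder-toTree []      = refl
inorder-toTree (x ∷ w) = trans (inorder-consTree x (toTree w)) (cong (x ∷_) (inorder-toTree w))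

consTree-decreasing : ∀ x {t} → Decreasing t → x ∉ inorder t → Decreasing (consTree x t)
consTree-decreasing x leaf _ = node leaf [] leaf []
consTree-decreasing x {node l y r} d@(node dl al dr ar) x∉ with y <? x
... | yes y<x rewrite <ᵇ-true y<x =
  node leaf [] d (All-++⁺ (All.map (λ z<y → <-trans z<y y<x) al)
                          (y<x ∷ All.map (λ z<y → <-trans z<y y<x) ar))
... | no y≮x rewrite <ᵇ-false y≮x =
  node (consTree-decreasing x dl (x∉ ∘ ∈-++⁺ˡ))
       (subst (All (_< y)) (sym (inorder-consTree x l))
         (≤∧≢⇒< (≮⇒≥ y≮x) (λ { refl → x∉ (∈-insert (inorder l)) }) ∷ al))
       dr ar

toTree-decreasing : ∀ {w} → Unique w → Decreasing (toTree w)
toTree-decreasing {[]}    _       = leaf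
toTree-decreasing {x ∷ w} u@(_ ∷ v) =
  consTree-decreasing x (toTree-decreasing v)
    (Unique[x∷xs]⇒x∉xs u ∘ subst (x ∈_) (inorder-toTree w))

-- Agreement of tree flips with valley-hopping

null-inorder : ∀ t → null (inorder t) ≡ isLeaf t
null-inorder leaf         = refl
null-inorder (node l x r) with inorder l
... | []    = refl
... | _ ∷ _ = refl

-- The link between trees and words: `w₂` and `w₄` are the readings of the two subtrees of `x`, and
-- `w₁` and `w₅` are what lies outside the subtree rooted at `x`.
record FlipFactors (x : ℕ) (t : Tree) : Set where
  field
    w₁ w₂ w₄ w₅ : List ℕ
    before      : inorder t ≡ w₁ ++ w₂ ++ x ∷ w₄ ++ w₅
    after       : inorder (flip x t) ≡ hop x w₁ w₂ w₄ w₅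
    isFactors   : Factors x w₁ w₂ w₄ w₅

hop-++ˡ : ∀ x us w₁ w₂ w₄ w₅ → us ++ hop x w₁ w₂ w₄ w₅ ≡ hop x (us ++ w₁) w₂ w₄ w₅
hop-++ˡ x us w₁ w₂ w₄ w₅ with null w₂ xor null w₄
... | true  = sym (++-assoc us w₁ _)
... | false = sym (++-assoc us w₁ _)

++-assoc₄ : ∀ {A : Set} (as bs cs ds es : List A) {x} →
            (as ++ bs ++ x ∷ cs ++ ds) ++ es ≡ as ++ bs ++ x ∷ cs ++ ds ++ es
++-assoc₄ as bs cs ds es {x}
  rewrite ++-assoc as (bs ++ x ∷ cs ++ ds) es | ++-assoc bs (x ∷ cs ++ ds) es | ++-assoc cs ds es = refl

hop-++ʳ : ∀ x w₁ w₂ w₄ w₅ us → hop x w₁ w₂ w₄ w₅ ++ us ≡ hop x w₁ w₂ w₄ (w₅ ++ us)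
hop-++ʳ x w₁ w₂ w₄ w₅ us with null w₂ xor null w₄
... | true  = ++-assoc₄ w₁ w₄ w₂ w₅ us
... | false = ++-assoc₄ w₁ w₂ w₄ w₅ us

reverse-mid : ∀ {A : Set} (us : List A) y vs → reverse (us ++ y ∷ vs) ≡ reverse vs ++ y ∷ reverse us
reverse-mid us y vs
  rewrite reverse-++ us (y ∷ vs) | unfold-reverse y vs = ++-assoc (reverse vs) (y ∷ []) (reverse us)

flip-≢ : ∀ x l {y} r → x ≢ y → flip x (node l y r) ≡ node (flip x l) y (flip x r)
flip-≢ x l {y} r x≢y rewrite ≡ᵇ-false {x} {y} x≢y = refl

inorder-flip-root : ∀ x l r → x ∉ inorder l → x ∉ inorder r →
                    inorder (flip x (node l x r)) ≡ hop x [] (inorder l) (inorder r) []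
inorder-flip-root x l r x∉l x∉r
  rewrite ≡ᵇ-refl x | flip-∉ x l x∉l | flip-∉ x r x∉r | null-inorder l | null-inorder r
  with isLeaf l xor isLeaf r
... | true  = cong (λ z → inorder r ++ x ∷ z) (sym (++-identityʳ (inorder l)))
... | false = cong (λ z → inorder l ++ x ∷ z) (sym (++-identityʳ (inorder r)))

-- The subtrees of `x` contain only smaller letters, and the letter just beyond them on either side
-- is an ancestor, hence larger, or is missing. So they read the two maximal runs. The induction
-- descends to `x` and appends the rest of the word on the outside.
flipFactors : ∀ x {t} → Decreasing t → Unique (inorder t) → x ∈ inorder t → FlipFactors x t
flipFactors x {node l y r} (node dl al dr ar) u x∈ with ∈-++⁻ (inorder l) x∈
... | inj₁ x∈l = record
  { w₁ = w₁ ; w₂ = w₂ ; w₄ = w₄ ; w₅ = w₅ ++ y ∷ inorder r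
  ; before    = trans (cong (_++ y ∷ inorder r) before) (++-assoc₄ w₁ w₂ w₄ w₅ (y ∷ inorder r))
  ; after     = trans (cong inorder (flip-≢ x l r (<⇒≢ x<y)))
                  (trans (cong₂ (λ a b → a ++ y ∷ inorder b) after (flip-∉ x r x∉r))
                    (hop-++ʳ x w₁ w₂ w₄ w₅ (y ∷ inorder r)))
  ; isFactors = factors left-stop left-small right-small (HeadGt-++ right-stop x<y)
  }
  where
  open FlipFactors (flipFactors x dl (Unique-++⁻ˡ (inorder l) u) x∈l)
  open Factors isFactors
  x<y : x < y
  x<y = All.lookup al x∈l
  x∉r : x ∉ inorder r
  x∉r x∈r = Unique-disjoint (inorder l) u x∈l (there x∈r)
... | inj₂ (here refl) = record
  { w₁ = [] ; w₂ = inorder l ; w₄ = inorder r ; w₅ = []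
  ; before    = cong (λ z → inorder l ++ x ∷ z) (sym (++-identityʳ (inorder r)))
  ; after     = inorder-flip-root x l r (<-irrefl refl ∘ All.lookup al) (<-irrefl refl ∘ All.lookup ar)
  ; isFactors = factors none al ar none
  }
... | inj₂ (there x∈r) = record
  { w₁ = inorder l ++ y ∷ w₁ ; w₂ = w₂ ; w₄ = w₄ ; w₅ = w₅
  ; before    = trans (cong (λ z → inorder l ++ y ∷ z) before) (sym (++-assoc (inorder l) (y ∷ w₁) _))
  ; after     = trans (cong inorder (flip-≢ x l r (<⇒≢ x<y)))
                  (trans (cong₂ (λ a b → inorder a ++ y ∷ b) (flip-∉ x l x∉l) after)
                    (trans (cong (inorder l ++_) (hop-++ˡ x (y ∷ []) w₁ w₂ w₄ w₅))
                      (hop-++ˡ x (inorder l) (y ∷ w₁) w₂ w₄ w₅)))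
  ; isFactors = factors
      (subst (HeadGt x) (sym (reverse-mid (inorder l) y w₁)) (HeadGt-++ left-stop x<y))
      left-small right-small right-stop
  }
  where
  unique-r : Unique (inorder r)
  unique-r with _ ∷ v ← Unique-++⁻ʳ (inorder l) u = v
  open FlipFactors (flipFactors x dr unique-r x∈r)
  open Factors isFactors
  x<y : x < y
  x<y = All.lookup ar x∈r
  x∉l : x ∉ inorder l
  x∉l x∈l = Unique-disjoint (inorder l) u x∈l (there x∈r)

φ-inorder : ∀ x {t} → Decreasing t → Unique (inorder t) → x ∈ inorder t →
            φ x (inorder t) ≡ inorder (flip x t)
φ-inorder x {t} d u x∈ =
  trans (cong (φ x) before) (trans (φ-factors w₁ w₂ isFactors (subst Unique before u)) (sym after))
  where open FlipFactors (flipFactors x d u x∈)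

-- Cycles of a word

range1-↗ : ∀ n → AllPairs _<_ (range1 n)
range1-↗ n = AllPairs.map⁺ (AllPairs.applyUpTo⁺₁ id n (λ i<j _ → s≤s i<j))

range1-unique : ∀ n → Unique (range1 n)
range1-unique n = AllPairs.map⁺ (AllPairs.applyUpTo⁺₁ id n (λ i<j _ → <⇒≢ i<j ∘ suc-injective))

length-range1 : ∀ n → length (range1 n) ≡ n
length-range1 n = trans (length-map suc (upTo n)) (length-upTo n)

range1-positive : ∀ {n x} → x ∈ range1 n → 0 < x
range1-positive x∈ with _ , _ , refl ← ∈-map⁻ suc x∈ = s≤s z≤n

app-applyUpTo : ∀ (h : ℕ → ℕ) {n i} → i < n → app (applyUpTo h n) (suc i) ≡ h i
app-applyUpTo h {suc n} {zero}  _   = refl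
app-applyUpTo h {suc n} {suc i} i<n = app-applyUpTo (h ∘ suc) (s≤s⁻¹ i<n)

map-range1 : ∀ (h : ℕ → ℕ) n → map h (range1 n) ≡ applyUpTo (h ∘ suc) n
map-range1 h n = trans (cong (map h) (map-upTo suc n)) (map-applyUpTo suc h n)

app-map-range1 : ∀ (h : ℕ → ℕ) {n x} → x ∈ range1 n → app (map h (range1 n)) x ≡ h x
app-map-range1 h {n} x∈ with i , i∈ , refl ← ∈-map⁻ suc x∈
  rewrite map-range1 h n = app-applyUpTo (h ∘ suc) (∈-upTo⁻ i∈)

-- Indexed by a strict lower bound for the first letters of the cycles.
data Canonical : ℕ → List (List ℕ) → Set where
  []   : ∀ {m} → Canonical m []
  cons : ∀ {m f r cs} → m < f → All (_≤ f) r → Canonical f cs → Canonical m ((f ∷ r) ∷ cs)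

cutAux-≤ : ∀ m w → All (_≤ m) (proj₁ (cutAux m w))
cutAux-≤ m []      = []
cutAux-≤ m (x ∷ w) with m <ᵇ x in eq
... | true  = []
... | false = ≮⇒≥ (λ m<x → subst T eq (<⇒<ᵇ m<x)) ∷ cutAux-≤ m w

cutAux-canonical : ∀ m w → Canonical m (proj₂ (cutAux m w))
cutAux-canonical m []      = []
cutAux-canonical m (x ∷ w) with m <ᵇ x in eq
... | true  = cons (<ᵇ⇒< m x (subst T (sym eq) _)) (cutAux-≤ x w) (cutAux-canonical x w)
... | false = cutAux-canonical m w

cutAux-concat : ∀ m w → proj₁ (cutAux m w) ++ concat (proj₂ (cutAux m w)) ≡ w
cutAux-concat m []      = refl
cutAux-concat m (x ∷ w) with m <ᵇ x
... | true  = cong (x ∷_) (cutAux-concat x w)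
... | false = cong (x ∷_) (cutAux-concat m w)

-- `cycles` discards the first component of `cutAux`. It is empty here: with initial bound 0 a
-- positive first letter already opens a cycle.
concat-cycles : ∀ {w} → All (0 <_) w → concat (cycles w) ≡ w
concat-cycles {w} pos with cutAux 0 w | cutAux-≤ 0 w | cutAux-concat 0 w
... | []    , cs | _         | eq   = eq
... | y ∷ _ , cs | y≤0 ∷ _   | refl with 0<y ∷ _ ← pos = ⊥-elim (<⇒≱ 0<y y≤0)

canonical-heads : ∀ {m cs f r} → Canonical m cs → (f ∷ r) ∈ cs → m < f
canonical-heads (cons m<f _ _) (here refl) = m<f
canonical-heads (cons m<f _ c) (there p)   = <-trans m<f (canonical-heads c p)

canonical-tails : ∀ {m cs f r} → Canonical m cs → (f ∷ r) ∈ cs → All (_≤ f) r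
canonical-tails (cons _ r≤f _) (here refl) = r≤f
canonical-tails (cons _ _ c)   (there p)   = canonical-tails c p

canonical-nonempty : ∀ {m cs} → Canonical m cs → [] ∉ cs
canonical-nonempty (cons _ _ c) (there p) = canonical-nonempty c p

-- p lists the points met when iterating h from x, up to but excluding the arrival at z.
data Path (h : ℕ → ℕ) : ℕ → List ℕ → ℕ → Set where
  []   : ∀ {x} → Path h x [] x
  step : ∀ {x p z} → Path h (h x) p z → Path h x (x ∷ p) z

path-split : ∀ {h x y z} us {vs} → Path h x (us ++ y ∷ vs) z → Path h y (y ∷ vs) z
path-split []       p@(step _) = p
path-split (_ ∷ us) (step p)   = path-split us p

path-cong : ∀ {h g x p z} → All (λ y → h y ≡ g y) p → Path h x p z → Path g x p z
path-cong []         []       = []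
path-cong (eq ∷ eqs) (step p) = step (path-cong eqs (subst (λ y → Path _ y _ _) eq p))

path-map : ∀ {h x p z} → Path h x (x ∷ p) z → map h (x ∷ p) ≡ p ++ z ∷ []
path-map {p = []}    (step [])         = refl
path-map {p = _ ∷ _} (step q@(step _)) = cong (_ ∷_) (path-map q)

if-just : ∀ {A : Set} b {u v : A} {m} → (if b then just u else m) ≡ just v → T b ⊎ m ≡ just v
if-just true  _  = inj₁ _
if-just false eq = inj₂ eq

nextAfter-∈ : ∀ f ys {x z} → nextAfter f ys x ≡ just z → x ∈ ys
nextAfter-∈ f (y ∷ [])     {x} eq with inj₁ y≡x ← if-just (y ≡ᵇ x) eq =
  here (sym (≡ᵇ⇒≡ y x y≡x))
nextAfter-∈ f (y ∷ t ∷ ys) {x} eq =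
  [ here ∘ sym ∘ ≡ᵇ⇒≡ y x , there ∘ nextAfter-∈ f (t ∷ ys) ]′ (if-just (y ≡ᵇ x) eq)

-- The end point `f` stays fixed while the start `y` moves along the cycle, as the induction
-- requires; only the last letter returns to `f`. Distinctness ensures that the search for a later
-- letter passes over `y`.
nextAfter-path : ∀ {h f y ys} → Unique (y ∷ ys) →
                 (∀ {x z} → nextAfter f (y ∷ ys) x ≡ just z → h x ≡ z) → Path h y (y ∷ ys) f
nextAfter-path {h} {f} {y} {[]} u next =
  step (subst (λ z → Path h z [] f) (sym (next (cong (λ b → if b then just f else nothing) (≡ᵇ-refl y)))) [])
nextAfter-path {h} {f} {y} {z ∷ ys} u@(_ ∷ v) next =
  step (subst (λ x → Path h x (z ∷ ys) f) 
    (sym (next (cong (λ b → if b then just z else nextAfter f (z ∷ ys) y) (≡ᵇ-refl y))))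
    (nextAfter-path v later))
  where
  later : ∀ {x t} → nextAfter f (z ∷ ys) x ≡ just t → h x ≡ t
  later {x} eq = next (trans
    (cong (λ b → if b then just z else nextAfter f (z ∷ ys) x)
      (≡ᵇ-false {y} (λ { refl → Unique[x∷xs]⇒x∉xs u (nextAfter-∈ f (z ∷ ys) eq) }))) eq)

-- The cycles are disjoint, so the search in every earlier cycle fails.
imgCycles-nextAfter : ∀ {cs f r x y} → Unique (concat cs) → (f ∷ r) ∈ cs →
                      nextAfter f (f ∷ r) x ≡ just y → imgCycles cs x ≡ y
imgCycles-nextAfter _ (here refl) eq rewrite eq = refl
imgCycles-nextAfter {[] ∷ cs} u (there p) eq = imgCycles-nextAfter u p eq
imgCycles-nextAfter {(g ∷ s) ∷ cs} {f} {r} {x} u (there p) eq with nextAfter g (g ∷ s) x in eq′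
... | just _  = ⊥-elim (Unique-disjoint (g ∷ s) u (nextAfter-∈ g (g ∷ s) eq′)
                          (∈-concat⁺′ (nextAfter-∈ f (f ∷ r) eq) p))
... | nothing = imgCycles-nextAfter (Unique-++⁻ʳ (g ∷ s) u) p eq

Unique-concat⁻ : ∀ {A : Set} {c : List A} {cs} → Unique (concat cs) → c ∈ cs → Unique c
Unique-concat⁻ {cs = c ∷ cs} u (here refl) = Unique-++⁻ˡ c u
Unique-concat⁻ {cs = c ∷ cs} u (there p)   = Unique-concat⁻ (Unique-++⁻ʳ c u) p

imgCycles-path : ∀ {cs f r} → Unique (concat cs) → (f ∷ r) ∈ cs → Path (imgCycles cs) f (f ∷ r) f
imgCycles-path u p = nextAfter-path (Unique-concat⁻ u p) (imgCycles-nextAfter u p)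

map-concat-↭ : ∀ {A : Set} (h : A → A) cs → (∀ {c} → c ∈ cs → map h c ↭ c) → map h (concat cs) ↭ concat cs
map-concat-↭ h []       _   = ↭-refl
map-concat-↭ h (c ∷ cs) rot rewrite map-++ h c (concat cs) =
  ++⁺ (rot (here refl)) (map-concat-↭ h cs (rot ∘ there))

-- On each cycle the map acts as a rotation, sending `f ∷ r` to `r` followed by `f`.
imgCycles-↭ : ∀ {cs} → Unique (concat cs) → map (imgCycles cs) (concat cs) ↭ concat cs
imgCycles-↭ {cs} u = map-concat-↭ (imgCycles cs) cs rotate
  where
  rotate : ∀ {c} → c ∈ cs → map (imgCycles cs) c ↭ c
  rotate {[]}    _ = ↭-refl
  rotate {f ∷ r} p = ↭-trans (↭-reflexive (path-map (imgCycles-path u p))) (↭-sym (∷↭∷ʳ f r))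

perm-unique : ∀ {n w} → w ↭ range1 n → Unique w
perm-unique {n} p = Unique-resp-↭ (↭-sym p) (range1-unique n)

perm-length : ∀ {n w} → w ↭ range1 n → length w ≡ n
perm-length {n} p = trans (↭-length p) (length-range1 n)

perm-cycles : ∀ {n w} → w ↭ range1 n → concat (cycles w) ≡ w
perm-cycles p = concat-cycles (All.tabulate (range1-positive ∘ ∈-resp-↭ p))

perm-cycles-unique : ∀ {n w} → w ↭ range1 n → Unique (concat (cycles w))
perm-cycles-unique p = subst Unique (sym (perm-cycles p)) (perm-unique p)

foataInv-↭ : ∀ {n w} → w ↭ range1 n → foataInv w ↭ range1 n
foataInv-↭ {n} {w} p rewrite perm-length p =
  ↭-trans (↭-map⁺ h (↭-sym p)) (↭-trans (subst (λ v → map h v ↭ v) (perm-cycles p)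
    (imgCycles-↭ {cycles w} (perm-cycles-unique p))) p)
  where
  h : ℕ → ℕ
  h = imgCycles (cycles w)

-- Unification extracts the local function allLe of isCycleMax, which has no accessible name.
mutual
  tailLe : List ℕ → ℕ → List ℕ → Bool
  tailLe = _

  isCycleMax-tailLe : ∀ τ m → isCycleMax τ m ≡ (m ≤ᵇ m) ∧ tailLe τ m (cycleGo τ m (length τ) (app τ m))
  isCycleMax-tailLe τ m with cycleGo τ m (length τ) (app τ m)
  ... | _ = refl

tailLe-true : ∀ τ m {ys} → All (_≤ m) ys → tailLe τ m ys ≡ true
tailLe-true τ m []       = refl
tailLe-true τ m (p ∷ ps) rewrite ≡true (≤⇒≤ᵇ p) = tailLe-true τ m ps

tailLe-false : ∀ τ m {y ys} → y ∈ ys → m < y → tailLe τ m ys ≡ false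
tailLe-false τ m {y} (here refl) m<y rewrite ≡false (<⇒≱ m<y ∘ ≤ᵇ⇒≤ y m) = refl
tailLe-false τ m {ys = z ∷ _} (there p) m<y with z ≤ᵇ m
... | true  = tailLe-false τ m p m<y
... | false = refl

-- Following a cycle in one-line notation

cycleGo-path : ∀ τ m k {x p z} → Path (app τ) x p z → m ∉ p →
               cycleGo τ m (length p + k) x ≡ p ++ cycleGo τ m k z
cycleGo-path τ m k []               m∉p = refl
cycleGo-path τ m k {x} (step q) m∉p
  rewrite ≡ᵇ-false {x} {m} (m∉p ∘ here ∘ sym) = cong (x ∷_) (cycleGo-path τ m k q (m∉p ∘ there))

cycleGo-end : ∀ τ m k → cycleGo τ m k m ≡ []
cycleGo-end τ m zero    = refl
cycleGo-end τ m (suc k) rewrite ≡ᵇ-refl m = refl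

-- The contribution of `m` to `foata τ`, named so that it can be reasoned about.
canonicalCycle : List ℕ → ℕ → List ℕ
canonicalCycle τ m = if isCycleMax τ m then cycleFrom τ m else []

-- The fuel suffices to traverse `r`; the walk is then back at `f`, where it stops whatever fuel
-- remains.
cycleGo-head : ∀ τ {f r} → Unique (f ∷ r) → Path (app τ) f (f ∷ r) f → length r ≤ length τ →
               cycleGo τ f (length τ) (app τ f) ≡ r
cycleGo-head τ {f} {r} u (step q) r≤τ =
  trans (cong (λ k → cycleGo τ f k (app τ f)) (sym (m+[n∸m]≡n r≤τ)))
    (trans (cycleGo-path τ f k q (Unique[x∷xs]⇒x∉xs u))
      (trans (cong (r ++_) (cycleGo-end τ f k)) (++-identityʳ r)))
  where
  k : ℕ
  k = length τ ∸ length r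

canonicalCycle-head : ∀ τ {f r} → Unique (f ∷ r) → All (_≤ f) r → Path (app τ) f (f ∷ r) f →
                      length r ≤ length τ → canonicalCycle τ f ≡ f ∷ r
canonicalCycle-head τ {f} {r} u r≤f q r≤τ
  rewrite isCycleMax-tailLe τ f | cycleGo-head τ u q r≤τ
        | tailLe-true τ f r≤f | ≡true (≤⇒≤ᵇ (≤-refl {f})) = refl

-- The walk from `y` passes through `p` without meeting `y` again, and the strict bound on
-- `length p` leaves one unit of fuel to record `z`.
cycleGo-∋ : ∀ τ {y p z} → y ≢ z → Unique (y ∷ p) → Path (app τ) y (y ∷ p) z → length p < length τ →
            z ∈ cycleGo τ y (length τ) (app τ y)
cycleGo-∋ τ {y} {p} {z} y≢z u (step q) p<τ =
  subst (z ∈_) (sym (trans (cong (λ k → cycleGo τ y k (app τ y)) length≡)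
                          (cycleGo-path τ y (suc k) q (Unique[x∷xs]⇒x∉xs u))))
    (∈-++⁺ʳ p z∈)
  where
  k : ℕ
  k = length τ ∸ suc (length p)
  length≡ : length τ ≡ length p + suc k
  length≡ = trans (sym (m+[n∸m]≡n p<τ)) (sym (+-suc (length p) k))
  z∈ : z ∈ cycleGo τ y (suc k) z
  z∈ rewrite ≡ᵇ-false (y≢z ∘ sym) = here refl

-- Started at a later letter `y` of the cycle, the walk reaches the larger letter `f`, so `y` fails
-- the test for being a cycle maximum.
canonicalCycle-tail : ∀ τ {f y} r₁ {r₂} → Unique (f ∷ r₁ ++ y ∷ r₂) → y ≤ f →
                      Path (app τ) f (f ∷ r₁ ++ y ∷ r₂) f → length r₂ < length τ → canonicalCycle τ y ≡ []
canonicalCycle-tail τ {f} {y} r₁ {r₂} u y≤f q r₂<τ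
  with y≢f ← ≢-sym (All.lookup (head u) (∈-insert r₁))
  rewrite isCycleMax-tailLe τ y
        | tailLe-false τ y (cycleGo-∋ τ y≢f (Unique-++⁻ʳ (f ∷ r₁) u) (path-split (f ∷ r₁) q) r₂<τ)
                           (≤∧≢⇒< y≤f y≢f)
        | ≡true (≤⇒≤ᵇ (≤-refl {y})) = refl
-- Both `rs` and the first letters of `cs` increase, so one simultaneous scan suffices: the head of
-- `rs` either opens the first cycle or lies below every first letter and contributes nothing.
concatMap-canonical : ∀ {m} (g : ℕ → List ℕ) {rs cs} → AllPairs _<_ rs → Canonical m cs →
  (∀ {f r} → (f ∷ r) ∈ cs → f ∈ rs × g f ≡ f ∷ r) →
  (∀ {x} → x ∈ rs → (∀ {r} → (x ∷ r) ∉ cs) → g x ≡ []) →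
  concatMap g rs ≡ concat cs
concatMap-canonical g [] []           _     _    = refl
concatMap-canonical g [] (cons _ _ _) heads _ with () , _ ← heads (here refl)
concatMap-canonical g (x< ∷ ↗) [] heads rest
  rewrite rest (here refl) (λ ()) = concatMap-canonical {0} g ↗ [] (λ ()) (λ x∈ _ → rest (there x∈) (λ ()))
concatMap-canonical g {x ∷ rs} {(f ∷ r) ∷ cs} (x< ∷ ↗) c@(cons m<f r≤f c′) heads rest with x ≟ f
... | yes refl = cong₂ _++_ (proj₂ (heads (here refl)))
                   (concatMap-canonical g ↗ c′ heads′ rest′)
  where
  heads′ : ∀ {f r} → (f ∷ r) ∈ cs → f ∈ rs × g f ≡ f ∷ r
  heads′ p with heads (there p)
  ... | here refl , _  = ⊥-elim (<-irrefl refl (canonical-heads c′ p))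
  ... | there q   , eq = q , eq
  rest′ : ∀ {y} → y ∈ rs → (∀ {s} → (y ∷ s) ∉ cs) → g y ≡ []
  rest′ y∈ ∉cs = rest (there y∈) λ
    { (here refl) → <-irrefl refl (All.lookup x< y∈)
    ; (there p)   → ∉cs p }
... | no x≢f = cong₂ _++_ (rest (here refl) (λ p → <⇒≱ x<f (f≤head p)))
                 (concatMap-canonical g ↗ c heads′ (rest ∘ there))
  where
  f≤head : ∀ {h s} → (h ∷ s) ∈ (f ∷ r) ∷ cs → f ≤ h
  f≤head (here refl) = ≤-refl
  f≤head (there p)   = <⇒≤ (canonical-heads c′ p)
  x<f : x < f
  x<f with proj₁ (heads (here refl))
  ... | here f≡x = ⊥-elim (x≢f (sym f≡x))
  ... | there f∈ = All.lookup x< f∈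
  heads′ : ∀ {h s} → (h ∷ s) ∈ (f ∷ r) ∷ cs → h ∈ rs × g h ≡ h ∷ s
  heads′ p with heads p
  ... | here refl , _  = ⊥-elim (<⇒≱ x<f (f≤head p))
  ... | there q   , eq = q , eq

length-∈-concat : ∀ {A : Set} {c : List A} {cs} → c ∈ cs → length c ≤ length (concat cs)
length-∈-concat {c = c} {cs = _ ∷ cs} (here refl) rewrite length-++ c {concat cs} = m≤m+n _ _
length-∈-concat {cs = d ∷ cs} (there p) rewrite length-++ d {concat cs} =
  ≤-trans (length-∈-concat p) (m≤n+m _ _)

-- Each cycle of `w` is a closed path of `app τ`, which agrees with `imgCycles` on the range. A
-- first letter regenerates its cycle and any other letter gives nothing, so the increasing scan
-- returns the cycles of `w` in their original order.
foata-foataInv : ∀ {n w} → w ↭ range1 n → foata (foataInv w) ≡ w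
foata-foataInv {n} {w} p rewrite perm-length p =
  trans (cong (concatMap (canonicalCycle τ) ∘ range1) (trans (length-map _ (range1 n)) (length-range1 n)))
    (trans (concatMap-canonical (canonicalCycle τ) (range1-↗ n) canonical heads rest) (perm-cycles p))
  where
  cs : List (List ℕ)
  cs = cycles w
  τ : List ℕ
  τ = map (imgCycles cs) (range1 n)
  canonical : Canonical 0 cs
  canonical = cutAux-canonical 0 w
  unique : Unique (concat cs)
  unique = perm-cycles-unique p
  ∈range : ∀ {c x} → c ∈ cs → x ∈ c → x ∈ range1 n
  ∈range c∈ x∈ = ∈-resp-↭ p (subst (_ ∈_) (perm-cycles p) (∈-concat⁺′ x∈ c∈))
  path : ∀ {f r} → (f ∷ r) ∈ cs → Path (app τ) f (f ∷ r) f
  path c∈ = path-cong (All.tabulate λ x∈ → sym (app-map-range1 (imgCycles cs) (∈range c∈ x∈)))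
                      (imgCycles-path unique c∈)
  short : ∀ {c} → c ∈ cs → length c ≤ length τ
  short c∈ = ≤-trans (length-∈-concat c∈) (≤-reflexive (trans (cong length (perm-cycles p))
    (trans (↭-length p) (sym (length-map _ (range1 n))))))
  heads : ∀ {f r} → (f ∷ r) ∈ cs → f ∈ range1 n × canonicalCycle τ f ≡ f ∷ r
  heads c∈ = ∈range c∈ (here refl) ,
    canonicalCycle-head τ (Unique-concat⁻ unique c∈) (canonical-tails canonical c∈) (path c∈) (<⇒≤ (short c∈))
  rest : ∀ {x} → x ∈ range1 n → (∀ {r} → (x ∷ r) ∉ cs) → canonicalCycle τ x ≡ []
  rest {x} x∈ ∉cs with ∈-concat⁻′ cs (subst (_ ∈_) (sym (perm-cycles p)) (∈-resp-↭ (↭-sym p) x∈))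
  ... | f ∷ r , here refl , c∈ = ⊥-elim (∉cs c∈)
  -- `x` is not the first letter of its cycle: `r₂` is what follows it before the walk returns to
  -- `f`.
  ... | f ∷ r , there x∈r , c∈ with r₁ , r₂ , refl ← ∈-∃++ x∈r =
    canonicalCycle-tail τ r₁ (Unique-concat⁻ unique c∈) (All.lookup (canonical-tails canonical c∈) x∈r)
      (path c∈) (<-≤-trans (s≤s r₂≤) (short c∈))
    where
    r₂≤ : length r₂ ≤ length (r₁ ++ x ∷ r₂)
    r₂≤ = ≤-trans (n≤1+n _) (≤-trans (m≤n+m _ (length r₁)) (≤-reflexive (sym (length-++ r₁))))

-- Fixed points and singleton cycles

Path-fixed : ∀ {h x p z} → Unique (x ∷ p) → Path h x (x ∷ p) z → h x ≡ x → p ≡ []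
Path-fixed {p = []}    _ _ _ = refl
Path-fixed {p = y ∷ p} u (step (step q)) hx≡x = ⊥-elim (Unique[x∷xs]⇒x∉xs u (here (sym hx≡x)))

fixed-singleton : ∀ {cs x} → Unique (concat cs) → x ∈ concat cs → imgCycles cs x ≡ x → (x ∷ []) ∈ cs
fixed-singleton {cs} {x} u x∈ fixed with ∈-concat⁻′ cs x∈
... | f ∷ r , x∈c , c∈ with ∈-∃++ x∈c
... | [] , bs , refl with refl ← Path-fixed (Unique-concat⁻ u c∈) (imgCycles-path u c∈) fixed = c∈
... | f ∷ as , bs , refl with path-split (f ∷ as) (imgCycles-path u c∈)
-- The path from `x` to `f` has length one, so the image of `x` is `f`; as `x` is fixed, `f` would
-- occur twice in its cycle.
... | q with refl ← Path-fixed (Unique-++⁻ʳ (f ∷ as) (Unique-concat⁻ u c∈)) q fixed with step [] ← q =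
  ⊥-elim (Unique-disjoint (f ∷ as) (Unique-concat⁻ u c∈) (here refl) (here fixed))

canonical-HeadGt : ∀ {m cs} → Canonical m cs → HeadGt m (concat cs)
canonical-HeadGt []             = none
canonical-HeadGt (cons m<f _ _) = some m<f

-- `p` accumulates the cycles already passed, whose letters are at most `m`. When the scan reaches
-- the cycle of `x` they all lie below `x`, and the next cycle, if any, opens with a larger letter.
singleton-cycle : ∀ {m cs x p} → Canonical m cs → (x ∷ []) ∈ cs → All (_≤ m) p →
  ∃₂ λ us vs → p ++ concat cs ≡ us ++ x ∷ vs × All (_< x) us × HeadGt x vs
singleton-cycle {cs = _ ∷ cs} {p = p} (cons m<x _ c) (here refl) p≤m =
  p , concat cs , refl , All.map (λ y≤m → ≤-<-trans y≤m m<x) p≤m , canonical-HeadGt c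
singleton-cycle {cs = (f ∷ r) ∷ cs} {p = p} (cons m<f r≤f c) (there x∈) p≤m
  with us , vs , eq , small , stop ←
    singleton-cycle c x∈ (All-++⁺ (All.map (λ y≤m → ≤-trans y≤m (<⇒≤ m<f)) p≤m) (≤-refl ∷ r≤f)) =
  us , vs , trans (sym (++-assoc p (f ∷ r) (concat cs))) eq , small , stop

-- The running maximum stays below `x` through `us`, so `x` opens a cycle; the next letter exceeds
-- `x` and opens another at once.
cutAux-singleton : ∀ {m x} us {vs} → m < x → All (_< x) us → HeadGt x vs →
                   (x ∷ []) ∈ proj₂ (cutAux m (us ++ x ∷ vs))
cutAux-singleton [] m<x _ none rewrite <ᵇ-true m<x = here refl
cutAux-singleton [] m<x _ (some x<y) rewrite <ᵇ-true m<x | <ᵇ-true x<y = here refl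
cutAux-singleton {m} (u ∷ us) m<x (u<x ∷ us<x) stop with m <ᵇ u
... | true  = there (cutAux-singleton us u<x us<x stop)
... | false = cutAux-singleton us m<x us<x stop

mid-injective : ∀ {x} us {vs} us′ {vs′ : List ℕ} → x ∉ us → x ∉ us′ →
                us ++ x ∷ vs ≡ us′ ++ x ∷ vs′ → us ≡ us′ × vs ≡ vs′
mid-injective {x} us us′ x∉us x∉us′ eq
  with refl ← trans (sym (splitAt′-++ us x∉us)) (trans (cong (splitAt' x) eq) (splitAt′-++ us′ x∉us′)) =
  refl , refl

path-end : ∀ {h x z} → Path h x [] z → x ≡ z
path-end [] = refl

imgCycles-fixed : ∀ {n x} us {vs} → us ++ x ∷ vs ↭ range1 n → All (_< x) us → HeadGt x vs →
                  imgCycles (cycles (us ++ x ∷ vs)) x ≡ x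
imgCycles-fixed {n} {x} us p small stop
  with step q ← imgCycles-path {r = []} (perm-cycles-unique p)
                  (cutAux-singleton us (range1-positive (∈-resp-↭ p (∈-insert us))) small stop) =
  path-end q

-- The singleton cycle of `x` yields a decomposition of the word at `x` with the required
-- properties; as `x` occurs only once, it is the given decomposition.
imgCycles-fixed⁻ : ∀ {n x} us {vs} → us ++ x ∷ vs ↭ range1 n →
                   imgCycles (cycles (us ++ x ∷ vs)) x ≡ x → All (_< x) us × HeadGt x vs
imgCycles-fixed⁻ {n} {x} us {vs} p fixed
  with us′ , vs′ , eq , small , stop ←
    singleton-cycle {p = []} (cutAux-canonical 0 (us ++ x ∷ vs))
      (fixed-singleton (perm-cycles-unique p) (subst (x ∈_) (sym (perm-cycles p)) (∈-insert us)) fixed) []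
  with refl , refl ← mid-injective us us′ (Unique-mid us (perm-unique p) ∘ ∈-++⁺ˡ)
                       (<-irrefl refl ∘ All.lookup small)
                       (trans (sym (perm-cycles p)) eq) =
  small , stop

HeadGt-small : ∀ {x us} → HeadGt x us → All (_< x) us → null us ≡ true
HeadGt-small none       _         = refl
HeadGt-small (some x<y) (y<x ∷ _) = ⊥-elim (<-asym x<y y<x)

-- A nonempty `w₁` ends in a letter larger than `x`, and a nonempty `w₄` puts a smaller letter right
-- after `x`; either violates the criterion for a fixed point. If both are empty, `w₂` and `w₅`
-- satisfy it.
fixed-factors : ∀ {n x} w₁ w₂ w₄ {w₅} → Factors x w₁ w₂ w₄ w₅ → w₁ ++ w₂ ++ x ∷ w₄ ++ w₅ ↭ range1 n →
                (imgCycles (cycles (w₁ ++ w₂ ++ x ∷ w₄ ++ w₅)) x ≡ᵇ x) ≡ null w₁ ∧ null w₄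
fixed-factors {x = x} [] w₂ [] (factors _ small _ stop) p =
  ≡true (≡⇒≡ᵇ _ x (imgCycles-fixed w₂ p small stop))
fixed-factors {x = x} [] w₂ (y ∷ w₄) (factors _ _ (y<x ∷ _) _) p =
  ≡ᵇ-false (λ fixed → absurd (proj₂ (imgCycles-fixed⁻ w₂ p fixed)))
  where
  absurd : ∀ {ys} → ¬ HeadGt x (y ∷ ys)
  absurd (some x<y) = <-asym x<y y<x
fixed-factors {n} {x} (y ∷ w₁) w₂ w₄ {w₅} (factors lstop _ _ _) p =
  ≡ᵇ-false (λ fixed → absurd (imgCycles-fixed⁻ (y ∷ w₁ ++ w₂) (subst (_↭ range1 n) assoc p)
    (subst (λ v → imgCycles (cycles v) x ≡ x) assoc fixed)))
  where
  assoc : y ∷ w₁ ++ w₂ ++ x ∷ w₄ ++ w₅ ≡ (y ∷ w₁ ++ w₂) ++ x ∷ w₄ ++ w₅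
  assoc = sym (++-assoc (y ∷ w₁) w₂ _)
  absurd : ¬ (All (_< x) (y ∷ w₁ ++ w₂) × HeadGt x (w₄ ++ w₅))
  absurd (small , _) with () ← trans (sym (null-reverse (y ∷ w₁)))
    (HeadGt-small lstop (All-resp-↭ (↭-sym (↭-reverse (y ∷ w₁))) (++⁻ˡ (y ∷ w₁) small)))

-- Foata's transformation is a bijection

-- Pigeonhole principle: each letter of `xs` is removed from `ys` in turn, and the length bound
-- leaves nothing over.
Unique⊆⇒↭ : ∀ {A : Set} {xs ys : List A} → Unique xs → xs ⊆ ys → length ys ≤ length xs → xs ↭ ys
Unique⊆⇒↭ {xs = []} {[]} _ _ _ = ↭-refl
Unique⊆⇒↭ {xs = x ∷ xs} u@(_ ∷ v) xs⊆ys len with as , bs , refl ← ∈-∃++ (xs⊆ys (here refl)) =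
  ↭-trans (↭-prep x (Unique⊆⇒↭ v xs⊆ (s≤s⁻¹ (subst (_≤ _) (↭-length (shift x as bs)) len))))
          (↭-sym (shift x as bs))
  where
  xs⊆ : xs ⊆ as ++ bs
  xs⊆ p with ∈-resp-↭ (shift x as bs) (xs⊆ys (there p))
  ... | here refl = ⊥-elim (Unique[x∷xs]⇒x∉xs u p)
  ... | there q   = q

Unique-map : ∀ {A B : Set} (f : A → B) {xs} → (∀ {x y} → x ∈ xs → y ∈ xs → f x ≡ f y → x ≡ y) →
             Unique xs → Unique (map f xs)
Unique-map f inj [] = []
Unique-map f inj (x∉ ∷ u) =
  All-map⁺ (All.tabulate λ y∈ eq → All.lookup x∉ y∈ (inj (here refl) (there y∈) eq)) ∷
  Unique-map f (λ p q → inj (there p) (there q)) u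

map-↭-self : ∀ {A : Set} (f : A → A) {xs} → (∀ {x} → x ∈ xs → f x ∈ xs) →
             (∀ {x y} → x ∈ xs → y ∈ xs → f x ≡ f y → x ≡ y) → Unique xs → map f xs ↭ xs
map-↭-self f {xs} closed inj u = Unique⊆⇒↭ (Unique-map f inj u) f-xs⊆ (≤-reflexive (sym (length-map f xs)))
  where
  f-xs⊆ : map f xs ⊆ xs
  f-xs⊆ p with _ , x∈ , refl ← ∈-map⁻ f p = closed x∈

insertions : ℕ → List ℕ → List (List ℕ)
insertions x []       = (x ∷ []) ∷ []
insertions x (y ∷ ys) = (x ∷ y ∷ ys) ∷ map (y ∷_) (insertions x ys)

permutations : List ℕ → List (List ℕ)
permutations []       = [] ∷ []
permutations (x ∷ xs) = concatMap (insertions x) (permutations xs)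

∈-insertions⁺ : ∀ x us vs → us ++ x ∷ vs ∈ insertions x (us ++ vs)
∈-insertions⁺ x []       []       = here refl
∈-insertions⁺ x []       (_ ∷ _)  = here refl
∈-insertions⁺ x (u ∷ us) vs       = there (∈-map⁺ (u ∷_) (∈-insertions⁺ x us vs))

∈-insertions⁻ : ∀ x ys {w} → w ∈ insertions x ys → w ↭ x ∷ ys
∈-insertions⁻ x []       (here refl) = ↭-refl
∈-insertions⁻ x (y ∷ ys) (here refl) = ↭-refl
∈-insertions⁻ x (y ∷ ys) (there p) with _ , q , refl ← ∈-map⁻ (y ∷_) p =
  ↭-trans (↭-prep y (∈-insertions⁻ x ys q)) (↭-swap y x ↭-refl)

∈-permutations⁺ : ∀ xs {w} → w ↭ xs → w ∈ permutations xs
∈-permutations⁺ [] p rewrite ↭-empty-inv p = here refl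
∈-permutations⁺ (x ∷ xs) p with us , vs , refl ← ∈-∃++ (∈-resp-↭ (↭-sym p) (here refl)) =
  ∈-concat⁺′ (∈-insertions⁺ x us vs)
    (∈-map⁺ (insertions x) (∈-permutations⁺ xs (drop-∷ (↭-trans (↭-sym (shift x us vs)) p))))

∈-permutations⁻ : ∀ xs {w} → w ∈ permutations xs → w ↭ xs
∈-permutations⁻ []       (here refl) = ↭-refl
∈-permutations⁻ (x ∷ xs) p
  with _ , q , c∈ ← ∈-concat⁻′ (map (insertions x) (permutations xs)) p
  with ys , ys∈ , refl ← ∈-map⁻ (insertions x) c∈ =
  ↭-trans (∈-insertions⁻ x ys q) (↭-prep x (∈-permutations⁻ xs ys∈))

-- By counting: foataInv is an injective self-map of a finite set.
foataInv-surjective : ∀ {n τ} → τ ↭ range1 n → ∃ λ w → w ↭ range1 n × τ ≡ foataInv w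
foataInv-surjective {n} {τ} p =
  let w , w∈ , eq = ∈-map⁻ foataInv (∈-resp-↭ (↭-sym permuted) (into p)) in w , from w∈ , eq
  where
  all-perms : List (List ℕ)
  -- Deduplication supplies the distinctness on which the counting argument rests.
  all-perms = deduplicate (≡-dec _≟_) (permutations (range1 n))
  into : ∀ {w} → w ↭ range1 n → w ∈ all-perms
  into = ∈-deduplicate⁺ (≡-dec _≟_) ∘ ∈-permutations⁺ (range1 n)
  from : ∀ {w} → w ∈ all-perms → w ↭ range1 n
  from = ∈-permutations⁻ (range1 n) ∘ ∈-deduplicate⁻ (≡-dec _≟_) (permutations (range1 n))
  permuted : map foataInv all-perms ↭ all-perms
  permuted = map-↭-self foataInv (into ∘ foataInv-↭ ∘ from)
    (λ v∈ w∈ eq → trans (sym (foata-foataInv (from v∈))) (trans (cong foata eq) (foata-foataInv (from w∈))))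
    (deduplicate-! (permutations (range1 n)))

foata-↭ : ∀ {n τ} → τ ↭ range1 n → foata τ ↭ range1 n
foata-↭ {n} p with w , q , refl ← foataInv-surjective p = subst (_↭ range1 n) (sym (foata-foataInv q)) q

foataInv-foata : ∀ {n τ} → τ ↭ range1 n → foataInv (foata τ) ≡ τ
foataInv-foata p with w , q , refl ← foataInv-surjective p = cong foataInv (foata-foataInv q)

-- Orbits

φ-flip : ∀ {x w} → Unique w → x ∈ w → φ x w ≡ inorder (flip x (toTree w))
φ-flip {x} {w} u x∈ = trans (cong (φ x) (sym (inorder-toTree w)))
  (φ-inorder x (toTree-decreasing u) (subst Unique (sym (inorder-toTree w)) u)
    (subst (x ∈_) (sym (inorder-toTree w)) x∈))

φ-↭ : ∀ {x w} → Unique w → x ∈ w → φ x w ↭ w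
φ-↭ {x} {w} u x∈ = ↭-trans (↭-reflexive (φ-flip u x∈))
  (↭-trans (inorder-flip x (toTree w)) (↭-reflexive (inorder-toTree w)))

-- The flipped tree is again decreasing, so the second hop is read off from it directly, without
-- rebuilding a tree from the hopped word.
φ-φ-flip : ∀ {x y w} → Unique w → x ∈ w → y ∈ w → φ x (φ y w) ≡ inorder (flip x (flip y (toTree w)))
φ-φ-flip {x} {y} {w} u x∈ y∈ = trans (cong (φ x) (φ-flip u y∈))
  (φ-inorder x (flip-decreasing y (toTree-decreasing u))
    (Unique-resp-↭ p u) (∈-resp-↭ p x∈))
  where
  p : w ↭ inorder (flip y (toTree w))
  p = ↭-sym (↭-trans (inorder-flip y (toTree w)) (↭-reflexive (inorder-toTree w)))

φ-comm : ∀ {x y w} → Unique w → x ∈ w → y ∈ w → φ x (φ y w) ≡ φ y (φ x w)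
φ-comm {x} {y} {w} u x∈ y∈ = trans (φ-φ-flip u x∈ y∈)
  (trans (cong inorder (flip-comm x y (toTree w))) (sym (φ-φ-flip u y∈ x∈)))

φ-involutive : ∀ {x w} → Unique w → x ∈ w → φ x (φ x w) ≡ w
φ-involutive {x} {w} u x∈ = trans (φ-φ-flip u x∈ x∈)
  (trans (cong inorder (flip-involutive x (toTree w))) (inorder-toTree w))

φ-foata-↭ : ∀ {n x τ} → x ∈ range1 n → τ ↭ range1 n → φ x (foata τ) ↭ range1 n
φ-foata-↭ x∈ p = ↭-trans (φ-↭ (perm-unique (foata-↭ p)) (∈-resp-↭ (↭-sym (foata-↭ p)) x∈)) (foata-↭ p)

ψ-↭ : ∀ {n x τ} → x ∈ range1 n → τ ↭ range1 n → ψ x τ ↭ range1 n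
ψ-↭ x∈ p = foataInv-↭ (φ-foata-↭ x∈ p)

-- Between the two hops `foata` cancels `foataInv`, which reduces the claim to `φ-comm`.
ψ-comm : ∀ {n x y τ} → x ∈ range1 n → y ∈ range1 n → τ ↭ range1 n → ψ x (ψ y τ) ≡ ψ y (ψ x τ)
ψ-comm {n} {x} {y} {τ} x∈ y∈ p = cong foataInv
  (trans (cong (φ x) (foata-foataInv (φ-foata-↭ y∈ p)))
    (trans (φ-comm (perm-unique (foata-↭ p)) (in-word x∈) (in-word y∈))
      (cong (φ y) (sym (foata-foataInv (φ-foata-↭ x∈ p))))))
  where
  in-word : ∀ {z} → z ∈ range1 n → z ∈ foata τ
  in-word = ∈-resp-↭ (↭-sym (foata-↭ p))

ψ-involutive : ∀ {n x τ} → x ∈ range1 n → τ ↭ range1 n → ψ x (ψ x τ) ≡ τ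
ψ-involutive {x = x} x∈ p = trans
  (cong foataInv (trans (cong (φ x) (foata-foataInv (φ-foata-↭ x∈ p)))
    (φ-involutive (perm-unique (foata-↭ p)) (∈-resp-↭ (↭-sym (foata-↭ p)) x∈))))
  (foataInv-foata p)

subsets-⊆ : ∀ {S} xs → S ∈ subsets xs → S ⊆ xs
subsets-⊆ []       (here refl) = id
subsets-⊆ (x ∷ xs) S∈ with ∈-++⁻ (subsets xs) S∈
... | inj₁ p = there ∘ subsets-⊆ xs p
... | inj₂ p with _ , q , refl ← ∈-map⁻ (x ∷_) p = λ
  { (here refl) → here refl
  ; (there r)   → there (subsets-⊆ xs q r) }

foldr-preserves : ∀ {A : Set} (f : ℕ → A → A) (P : A → Set) {a} S →
  (∀ {x b} → x ∈ S → P b → P (f x b)) → P a → P (foldr f a S)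
foldr-preserves f P []      pres pa = pa
foldr-preserves f P (x ∷ S) pres pa = pres (here refl) (foldr-preserves f P S (pres ∘ there) pa)

-- Applying `f x` toggles the membership of `x` in `S`. It commutes past the letters preceding `x`
-- in the fixed order of `xs`, then either joins `S` or cancels against the `f x` already there.
foldr-subsets-closed : ∀ {A : Set} (f : ℕ → A → A) (P : A → Set) {a x S} xs →
  (∀ {x b} → x ∈ xs → P b → P (f x b)) →
  (∀ {x y b} → x ∈ xs → y ∈ xs → P b → f x (f y b) ≡ f y (f x b)) →
  (∀ {x b} → x ∈ xs → P b → f x (f x b) ≡ b) →
  P a → x ∈ xs → S ∈ subsets xs → ∃ λ S′ → S′ ∈ subsets xs × f x (foldr f a S) ≡ foldr f a S′
foldr-subsets-closed f P {x = x} {S} (y ∷ xs) pres comm invol pa x∈ S∈ with ∈-++⁻ (subsets xs) S∈ | x∈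
... | inj₁ q | here refl = x ∷ S , ∈-++⁺ʳ (subsets xs) (∈-map⁺ (x ∷_) q) , refl
... | inj₁ q | there r
  with S′ , S′∈ , eq ← foldr-subsets-closed f P xs (pres ∘ there)
         (λ r s → comm (there r) (there s)) (invol ∘ there) pa r q =
  S′ , ∈-++⁺ˡ S′∈ , eq
... | inj₂ q | here refl with S₀ , S₀∈ , refl ← ∈-map⁻ (y ∷_) q =
  S₀ , ∈-++⁺ˡ S₀∈ , invol (here refl) (foldr-preserves f P S₀ (pres ∘ there ∘ subsets-⊆ xs S₀∈) pa)
... | inj₂ q | there r
  with S₀ , S₀∈ , refl ← ∈-map⁻ (y ∷_) q
  with S′ , S′∈ , eq ← foldr-subsets-closed f P xs (pres ∘ there)
         (λ r s → comm (there r) (there s)) (invol ∘ there) pa r S₀∈ =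
  y ∷ S′ , ∈-++⁺ʳ (subsets xs) (∈-map⁺ (y ∷_) S′∈) ,
  trans (comm (there r) (here refl) (foldr-preserves f P S₀ (pres ∘ there ∘ subsets-⊆ xs S₀∈) pa))
    (cong (f y) eq)

∈-orbit⁻ : ∀ {n τ σ} → length τ ≡ n → σ ∈ orbit τ → ∃ λ S → S ∈ subsets (range1 n) × σ ≡ ψS S τ
∈-orbit⁻ {τ = τ} refl σ∈ =
  ∈-map⁻ (λ S → ψS S τ) (∈-deduplicate⁻ (≡-dec _≟_) (map (λ S → ψS S τ) (subsets (range1 (length τ)))) σ∈)

∈-orbit⁺ : ∀ {n τ S} → length τ ≡ n → S ∈ subsets (range1 n) → ψS S τ ∈ orbit τ
∈-orbit⁺ {τ = τ} refl S∈ = ∈-deduplicate⁺ (≡-dec _≟_) (∈-map⁺ (λ S → ψS S τ) S∈)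

orbit-unique : ∀ τ → Unique (orbit τ)
orbit-unique τ = deduplicate-! (map (λ S → ψS S τ) (subsets (range1 (length τ))))

orbit-perms : ∀ {n τ σ} → τ ↭ range1 n → σ ∈ orbit τ → σ ↭ range1 n
orbit-perms {n} {τ} p σ∈ =
  let S , S∈ , σ≡ = ∈-orbit⁻ {τ = τ} (perm-length p) σ∈
  in subst (_↭ range1 n) (sym σ≡) (foldr-preserves ψ (_↭ range1 n) S (ψ-↭ ∘ subsets-⊆ (range1 n) S∈) p)

orbit-closed : ∀ {n τ σ x} → τ ↭ range1 n → x ∈ range1 n → σ ∈ orbit τ → ψ x σ ∈ orbit τ
orbit-closed {n} {τ} {x = x} p x∈ σ∈ =
  let S , S∈ , σ≡ = ∈-orbit⁻ {τ = τ} (perm-length p) σ∈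
      S′ , S′∈ , ψ≡ = foldr-subsets-closed ψ (_↭ range1 n) (range1 n) ψ-↭ ψ-comm ψ-involutive p x∈ S∈
  in subst (_∈ orbit τ) (sym (trans (cong (ψ x) σ≡) ψ≡)) (∈-orbit⁺ {τ = τ} (perm-length p) S′∈)

ψ-permutes-orbit : ∀ {n τ x} → τ ↭ range1 n → x ∈ range1 n → map (ψ x) (orbit τ) ↭ orbit τ
ψ-permutes-orbit {n} {τ} {x} p x∈ = map-↭-self (ψ x) (orbit-closed p x∈)
  (λ σ∈ ρ∈ eq → trans (sym (ψ-involutive x∈ (orbit-perms p σ∈)))
                  (trans (cong (ψ x) eq) (ψ-involutive x∈ (orbit-perms p ρ∈))))
  (orbit-unique τ)

-- Counting fixed points

indicator : Bool → ℕ
indicator b = if b then 1 else 0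

fixesAt : ℕ → List ℕ → ℕ
fixesAt x τ = indicator (app τ x ≡ᵇ x)

startsWith : ℕ → List ℕ → Bool
startsWith x []      = false
startsWith x (y ∷ _) = y ≡ᵇ x

-- `f` is specified only pointwise because the recursion of `applyUpTo` replaces it by `f ∘ suc`,
-- which is not literally `suc i +_`.
fixFrom-applyUpTo : ∀ i (f : ℕ → ℕ) → (∀ k → f k ≡ i + k) → ∀ xs →
  fixFrom i xs ≡ sum (applyUpTo (λ k → indicator (app xs (suc k) ≡ᵇ f k)) (length xs))
fixFrom-applyUpTo i f f≡ []       = refl
fixFrom-applyUpTo i f f≡ (x ∷ xs) rewrite trans (f≡ 0) (+-identityʳ i) =
  cong (_ +_) (fixFrom-applyUpTo (suc i) (f ∘ suc) (λ k → trans (f≡ (suc k)) (+-suc i k)) xs)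

fix-sum : ∀ τ → fix τ ≡ sum (map (λ x → fixesAt x τ) (range1 (length τ)))
fix-sum τ = trans (fixFrom-applyUpTo 1 suc (λ _ → refl) τ)
  (cong sum (sym (map-range1 (λ x → fixesAt x τ) (length τ))))

startsWith-mid : ∀ {x} w₁ w₂ {vs} → x ∉ w₁ ++ w₂ → startsWith x (w₁ ++ w₂ ++ x ∷ vs) ≡ null w₁ ∧ null w₂
startsWith-mid {x} []       []       _  = ≡ᵇ-refl x
startsWith-mid     []       (_ ∷ _)  x∉ = ≡ᵇ-false (x∉ ∘ here ∘ sym)
startsWith-mid     (_ ∷ _)  _        x∉ = ≡ᵇ-false (x∉ ∘ here ∘ sym)

-- In all four cases the right run after the hop is empty exactly when `w₂` is: the runs are
-- exchanged if just one is empty, and otherwise both are empty or both are not.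
fixed-hop : ∀ {n x} w₁ w₂ w₄ {w₅} → Factors x w₁ w₂ w₄ w₅ → hop x w₁ w₂ w₄ w₅ ↭ range1 n →
            (imgCycles (cycles (hop x w₁ w₂ w₄ w₅)) x ≡ᵇ x) ≡ null w₁ ∧ null w₂
fixed-hop w₁ []         []         F                   = fixed-factors w₁ [] [] F
fixed-hop w₁ []         w₄@(_ ∷ _) (factors ls l r rs) = fixed-factors w₁ w₄ [] (factors ls r l rs)
fixed-hop w₁ w₂@(_ ∷ _) []         (factors ls l r rs) = fixed-factors w₁ [] w₂ (factors ls r l rs)
fixed-hop w₁ w₂@(_ ∷ _) w₄@(_ ∷ _) F                   = fixed-factors w₁ w₂ w₄ F

-- Both sides say that `w₁` and `w₂` are empty, that is, that nothing precedes `x` in `w`.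
φ-fixed : ∀ {n x w} → w ↭ range1 n → x ∈ range1 n →
          (imgCycles (cycles (φ x w)) x ≡ᵇ x) ≡ startsWith x w
φ-fixed {n} {x} {w} p x∈ =
  trans (cong (λ v → imgCycles (cycles v) x ≡ᵇ x) φ≡)
    (trans (fixed-hop w₁ w₂ w₄ isFactors (subst (_↭ range1 n) φ≡ (↭-trans (φ-↭ u x∈w) p)))
      (sym (trans (cong (startsWith x) w≡) (startsWith-mid w₁ w₂ x∉))))
  where
  u : Unique w
  u = perm-unique p
  x∈w : x ∈ w
  x∈w = ∈-resp-↭ (↭-sym p) x∈
  open FlipFactors (flipFactors x (toTree-decreasing u) (subst Unique (sym (inorder-toTree w)) u)
                     (subst (x ∈_) (sym (inorder-toTree w)) x∈w))
  w≡ : w ≡ w₁ ++ w₂ ++ x ∷ w₄ ++ w₅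
  w≡ = trans (sym (inorder-toTree w)) before
  x∉ : x ∉ w₁ ++ w₂
  x∉ = Unique-mid (w₁ ++ w₂) (subst Unique (trans w≡ (sym (++-assoc w₁ w₂ _))) u) ∘ ∈-++⁺ˡ
  φ≡ : φ x w ≡ hop x w₁ w₂ w₄ w₅
  φ≡ = trans (φ-flip u x∈w) after

fixesAt-ψ : ∀ {n x τ} → x ∈ range1 n → τ ↭ range1 n → fixesAt x (ψ x τ) ≡ indicator (startsWith x (foata τ))
fixesAt-ψ {n} {x} {τ} x∈ p =
  trans (cong (λ y → indicator (y ≡ᵇ x))
          (app-map-range1 (imgCycles (cycles v)) (subst (λ k → x ∈ range1 k) (sym (perm-length v↭)) x∈)))
    (cong indicator (φ-fixed (foata-↭ p) x∈))
  where
  v : List ℕ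
  v = φ x (foata τ)
  v↭ : v ↭ range1 n
  v↭ = φ-foata-↭ x∈ p

-- Sums over lists and double counting

sum-cong : ∀ {A : Set} {f g : A → ℕ} {xs} → (∀ {x} → x ∈ xs → f x ≡ g x) → sum (map f xs) ≡ sum (map g xs)
sum-cong eq = cong sum (map-cong-local (All.tabulate eq))

sum-map-0 : ∀ {A : Set} (xs : List A) → sum (map (λ _ → 0) xs) ≡ 0
sum-map-0 []       = refl
sum-map-0 (_ ∷ xs) = sum-map-0 xs

sum-map-1 : ∀ {A : Set} (xs : List A) → sum (map (λ _ → 1) xs) ≡ length xs
sum-map-1 []       = refl
sum-map-1 (_ ∷ xs) = cong suc (sum-map-1 xs)

sum-map-+ : ∀ {A : Set} (f g : A → ℕ) xs → sum (map (λ x → f x + g x) xs) ≡ sum (map f xs) + sum (map g xs)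
sum-map-+ f g []       = refl
sum-map-+ f g (x ∷ xs) rewrite sum-map-+ f g xs = +-interchange (f x) (g x) (sum (map f xs)) (sum (map g xs))

sum-swap : ∀ {A B : Set} (f : A → B → ℕ) xs ys →
           sum (map (λ x → sum (map (f x) ys)) xs) ≡ sum (map (λ y → sum (map (λ x → f x y) xs)) ys)
sum-swap f []       ys = sym (sum-map-0 ys)
sum-swap f (x ∷ xs) ys rewrite sum-swap f xs ys =
  sym (sum-map-+ (f x) (λ y → sum (map (λ x → f x y) xs)) ys)

sum-indicator : ∀ {y xs} → Unique xs → y ∈ xs → sum (map (λ x → indicator (y ≡ᵇ x)) xs) ≡ 1
sum-indicator {y} {x ∷ xs} (x∉ ∷ _) (here refl) rewrite ≡ᵇ-refl y =
  cong suc (trans (sum-cong (λ z∈ → cong indicator (≡ᵇ-false (All.lookup x∉ z∈)))) (sum-map-0 xs))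
sum-indicator {y} {x ∷ xs} (x∉ ∷ u) (there y∈) rewrite ≡ᵇ-false (≢-sym (All.lookup x∉ y∈)) =
  sum-indicator u y∈

-- As `n` is positive the word has a first letter, and this letter occurs exactly once in the range.
sum-startsWith : ∀ {n w} → 1 ≤ n → w ↭ range1 n → sum (map (λ x → indicator (startsWith x w)) (range1 n)) ≡ 1
sum-startsWith {suc n} {[]}    _ p with () ← ↭-length p
sum-startsWith {n} {y ∷ w} _ p = sum-indicator (range1-unique n) (∈-resp-↭ p (here refl))

theorem26 : (n : ℕ) → 1 ≤ n → (τ : List ℕ) → τ ↭ range1 n →
    sum (map fix (orbit τ)) ≡ length (orbit τ)
theorem26 n 1≤n τ p = begin
  sum (map fix O)
    ≡⟨ sum-cong (λ {σ} σ∈ → trans (fix-sum σ)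
         (cong (λ k → sum (map (λ x → fixesAt x σ) (range1 k))) (perm-length (orbit-perms p σ∈)))) ⟩
  sum (map (λ σ → sum (map (λ x → fixesAt x σ) (range1 n))) O)
    ≡⟨ sum-swap (λ σ x → fixesAt x σ) O (range1 n) ⟩
  sum (map (λ x → sum (map (fixesAt x) O)) (range1 n))
    ≡⟨ sum-cong fixed≡first ⟩
  sum (map (λ x → sum (map (λ σ → indicator (startsWith x (foata σ))) O)) (range1 n))
    ≡⟨ sum-swap (λ σ x → indicator (startsWith x (foata σ))) O (range1 n) ⟨
  sum (map (λ σ → sum (map (λ x → indicator (startsWith x (foata σ))) (range1 n))) O)
    ≡⟨ sum-cong (λ σ∈ → sum-startsWith 1≤n (foata-↭ (orbit-perms p σ∈))) ⟩
  sum (map (λ _ → 1) O)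
    ≡⟨ sum-map-1 O ⟩
  length O ∎
  where
  open ≡-Reasoning
  O : List (List ℕ)
  O = orbit τ
  fixed≡first : ∀ {x} → x ∈ range1 n →
    sum (map (fixesAt x) O) ≡ sum (map (λ σ → indicator (startsWith x (foata σ))) O)
  fixed≡first {x} x∈ = begin
    -- The sum is reindexed along the permutation `ψ x` of the orbit, separately for each `x`.
    sum (map (fixesAt x) O)               ≡⟨ sum-↭ (↭-map⁺ (fixesAt x) (ψ-permutes-orbit p x∈)) ⟨
    sum (map (fixesAt x) (map (ψ x) O))   ≡⟨ cong sum (map-∘ O) ⟨
    sum (map (λ σ → fixesAt x (ψ x σ)) O) ≡⟨ sum-cong (fixesAt-ψ x∈ ∘ orbit-perms p) ⟩
    sum (map (λ σ → indicator (startsWith x (foata σ))) O) ∎
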